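{- Let $K=2$ and let $\alpha\in[0,1/2]$, where $\alpha=w_1$ and $1-\alpha=w_2$ are the OWA weights. If the deterministic problem $\mathcal{P}$ is polynomially solvable, then $\textsc{Min-Owa}~\mathcal{P}$ with two scenarios and weight vector $(\alpha,1-\alpha)$ is polynomially solvable.
   Context: A combinatorial optimization problem $\mathcal{P}$: each instance specifies a finite set of elements $E=\{e_1,\dots,e_n\}$, a set of feasible solutions $\Phi\subseteq 2^E$ (typically described implicitly), and a nonnegative cost $c_i$ for each $e_i\in E$; one seeks $X\in\Phi$ minimizing $\sum_{e_i\in X}c_i$. $\mathcal{P}$ is polynomially solvable if an optimal solution can be computed in polynomial time for all nonnegative costs. Uncertain version: instead of a single cost vector one is given a scenario set $\Gamma=\{\pmb{c}_1,\dots,\pmb{c}_K\}$ of $K$ distinct cost scenarios $\pmb{c}_j=(c_{1j},\dots,c_{nj})$ with nonnegative entries, and $F(X,\pmb{c}_j)=\sum_{e_i\in X}c_{ij}$. For a weight vector $\pmb{w}=(w_1,\dots,w_K)$ with $w_j\in[0,1]$ and $\sum_j w_j=1$, let $$\mathrm{OWA}(X)=\sum_{j=1}^K w_jF(X,\pmb{c}_{\sigma(j)}),$$ where $\sigma$ is a permutation of $\{1,\dots,K\}$ with $F(X,\pmb{c}_{\sigma(1)})\ge\dots\ge F(X,\pmb{c}_{\sigma(K)})$. $\textsc{Min-Owa}~\mathcal{P}$ is the problem $\min_{X\in\Phi}\mathrm{OWA}(X)$. For $K=2$ and weights $(\alpha,1-\alpha)$, $\mathrm{OWA}(X)=\alp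ha\max_jF(X,\pmb{c}_j)+(1-\alpha)\min_jF(X,\pmb{c}_j)$.
   Formalization: The costs in all scenarios and the weight α in [0,1/2] are taken to be rational numbers (binary numerator and denominator) rather than real numbers. -}

module Defs where

open import Algebra.Properties.CommutativeMonoid.Sum using (sum)
open import Data.Bool.Base using (Bool; true; false; if_then_else_)
open import Data.Fin.Base as Fin using (Fin; zero; suc; punchIn)
open import Data.Fin.Permutation as Perm using (Permutation′; _⟨$⟩ʳ_)
open import Data.Fin.Subset using (Subset)
open import Data.Integer.Base as ℤ using (+≤+)
open import Data.Maybe.Base using (Maybe; just; nothing)
open import Data.Nat.Base as ℕ using (ℕ; zero; suc)
open import Data.Nat.Logarithm using (⌊log₂_⌋)
open import Data.Product.Base using (Σ; ∃-syntax; _×_; _,_; proj₁)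
open import Data.Rational.Unnormalised.Base
open import Data.Rational.Unnormalised.Properties
open import Data.Sum.Base using (inj₁; inj₂)
open import Data.Vec.Base using (lookup)
open import Data.Vec.Functional using (Vector; []; _∷_)
open import Function.Base using (_∘_)
open import Function.Definitions using (Injective)
open import Relation.Binary.PropositionalEquality
  using (_≡_; _≢_; sym; subst₂)
open import Relation.Nullary using (¬_)

------------------------------------------------------------------------
-- Model of computation
--
-- A WHILE language on binary trees with natural numbers at the leaves,
-- in variable-free form, under the logarithmic cost criterion.  A
-- primitive costs the total bit size of its argument and result; hence a
-- run of cost t only handles values of size at most t, and the language
-- and Turing machines simulate each other with polynomial overhead.

data Val : Set where
  nat  : ℕ → Val
  pair : Val → Val → Val

size : Val → ℕ
size (nat k)    = suc ⌊log₂ k ⌋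
size (pair x y) = suc (size x ℕ.+ size y)

data Prim : Set where
  copy left right isPair add monus mul quot leq : Prim
  const                                         : ℕ → Prim

-- Primitives are total: a pair counts as 0 in arithmetic, the
-- components of a number are 0, and so are quotients by 0.
num : Val → ℕ
num (nat k)    = k
num (pair _ _) = 0

quotient : ℕ → ℕ → ℕ
quotient m zero    = 0
quotient m (suc n) = m ℕ./ suc n

arith : (ℕ → ℕ → ℕ) → Val → Val
arith f (nat _)    = nat 0
arith f (pair x y) = nat (f (num x) (num y))

bit : Bool → Val
bit b = nat (if b then 1 else 0)

eval : Prim → Val → Val
eval copy       x          = x
eval left       (nat _)    = nat 0
eval left       (pair x _) = x
eval right      (nat _)    = nat 0
eval right      (pair _ y) = y
eval isPair     (nat _)    = nat 0
eval isPair     (pair _ _) = nat 1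
eval add        x          = arith ℕ._+_ x
eval monus      x          = arith ℕ._∸_ x
eval mul        x          = arith ℕ._*_ x
eval quot       x          = arith quotient x
eval leq        x          = arith (λ m n → if m ℕ.≤ᵇ n then 1 else 0) x
eval (const k)  _          = nat k

infixr 9 _⨾_

data Prog : Set where
  prim        : Prim → Prog
  _⨾_         : Prog → Prog → Prog
  fork        : Prog → Prog → Prog
  branch      : Prog → Prog → Prog → Prog
  while_loop_ : Prog → Prog → Prog

-- p ⊢ x ⇓ y [ t ]: on input x, program p halts with output y at cost t.
-- Tests fail exactly on nat 0.
data _⊢_⇓_[_] : Prog → Val → Val → ℕ → Set where
  run-prim  : ∀ {f x} → prim f ⊢ x ⇓ eval f x [ size x ℕ.+ size (eval f x) ]
  run-⨾     : ∀ {p q x y z s t} →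
              p ⊢ x ⇓ y [ s ] → q ⊢ y ⇓ z [ t ] → (p ⨾ q) ⊢ x ⇓ z [ s ℕ.+ t ]
  run-fork  : ∀ {p q x y z s t} →
              p ⊢ x ⇓ y [ s ] → q ⊢ x ⇓ z [ t ] →
              fork p q ⊢ x ⇓ pair y z [ suc (s ℕ.+ t) ]
  run-then  : ∀ {c p q x b y s t} →
              c ⊢ x ⇓ b [ s ] → b ≢ nat 0 → p ⊢ x ⇓ y [ t ] →
              branch c p q ⊢ x ⇓ y [ suc (s ℕ.+ t) ]
  run-else  : ∀ {c p q x y s t} →
              c ⊢ x ⇓ nat 0 [ s ] → q ⊢ x ⇓ y [ t ] →
              branch c p q ⊢ x ⇓ y [ suc (s ℕ.+ t) ]
  run-stop  : ∀ {c p x s} →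
              c ⊢ x ⇓ nat 0 [ s ] → (while c loop p) ⊢ x ⇓ x [ suc s ]
  run-again : ∀ {c p x b y z s t u} →
              c ⊢ x ⇓ b [ s ] → b ≢ nat 0 → p ⊢ x ⇓ y [ t ] →
              (while c loop p) ⊢ y ⇓ z [ u ] →
              (while c loop p) ⊢ x ⇓ z [ suc (s ℕ.+ t ℕ.+ u) ]

list : ∀ {n} → Vector Val n → Val
list {zero}  _ = nat 0
list {suc n} v = pair (v zero) (list (v ∘ suc))

-- Only used for nonnegative fractions, so the sign is dropped.  Fractions
-- need not be in lowest terms.
encodeℚ : ℚᵘ → Val
encodeℚ q = pair (nat ℤ.∣ ↥ q ∣) (nat (↧ₙ q))

encodeSubset : ∀ {n} → Subset n → Val
encodeSubset X = list (bit ∘ lookup X)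

encodeAnswer : ∀ {n} → Maybe (Subset n) → Val
encodeAnswer nothing  = nat 0
encodeAnswer (just X) = pair (nat 1) (encodeSubset X)

------------------------------------------------------------------------
-- Polynomially solvable minimization problems

record MinProblem : Set₁ where
  field
    Instance  : Set
    encode    : Instance → Val
    ground    : Instance → ℕ
    Feasible  : (I : Instance) → Subset (ground I) → Set
    objective : (I : Instance) → Subset (ground I) → ℚᵘ

  Optimal : (I : Instance) → Subset (ground I) → Set
  Optimal I X = Feasible I X × (∀ Y → Feasible I Y → objective I X ≤ objective I Y)

  Correct : (I : Instance) → Maybe (Subset (ground I)) → Set
  Correct I (just X) = Optimal I X
  Correct I nothing  = ∀ Y → ¬ Feasible I Y

-- Sizes are positive, so every polynomial in the size is bounded by a
-- monomial a * size ^ d.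
PolynomiallySolvable : MinProblem → Set
PolynomiallySolvable Q =
  ∃[ p ] ∃[ a ] ∃[ d ] ∀ (I : Instance) → ∃[ answer ] ∃[ t ]
    p ⊢ encode I ⇓ encodeAnswer answer [ t ]
    × t ℕ.≤ a ℕ.* size (encode I) ℕ.^ d
    × Correct I answer
  where open MinProblem Q

------------------------------------------------------------------------
-- Combinatorial optimization problems

-- A structure is an instance without its costs (e.g. a graph with two
-- terminals); it describes the set Φ of feasible solutions implicitly.
record CombinatorialProblem : Set₁ where
  field
    Structure        : Set
    encode           : Structure → Val
    encode-injective : Injective _≡_ _≡_ encode
    elements         : Structure → ℕ
    Φ                : (S : Structure) → Subset (elements S) → Set

Σℚ : ∀ {n} → Vector ℚᵘ n → ℚᵘ
Σℚ = sum +-0-commutativeMonoid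

F : ∀ {n} → Subset n → Vector ℚᵘ n → ℚᵘ
F X c = Σℚ (λ i → if lookup X i then c i else 0ℚᵘ)

CostVector : ℕ → Set
CostVector n = Σ (Vector ℚᵘ n) λ c → ∀ i → 0ℚᵘ ≤ c i

encodeCosts : ∀ {n} → CostVector n → Val
encodeCosts (c , _) = list (encodeℚ ∘ c)

deterministic : CombinatorialProblem → MinProblem
deterministic P = record
  { Instance  = Σ Structure λ S → CostVector (elements S)
  ; encode    = λ (S , c) → pair (encode S) (encodeCosts c)
  ; ground    = λ (S , _) → elements S
  ; Feasible  = λ (S , _) → Φ S
  ; objective = λ (_ , c) X → F X (proj₁ c)
  }
  where open CombinatorialProblem P

------------------------------------------------------------------------
-- Ordered weighted averaging

record WeightVector (K : ℕ) : Set where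
  field
    weight   : Vector ℚᵘ K
    weight≥0 : ∀ j → 0ℚᵘ ≤ weight j
    weight≤1 : ∀ j → weight j ≤ 1ℚᵘ
    weight-Σ : Σℚ weight ≃ 1ℚᵘ

open WeightVector public

Nonincreasing : ∀ {K} → Vector ℚᵘ K → Set
Nonincreasing v = ∀ {i j} → i Fin.≤ j → v j ≤ v i

private
  argmax : ∀ {K} (v : Vector ℚᵘ (suc K)) → ∃[ m ] ∀ i → v i ≤ v m
  argmax {zero}  v = zero , λ { zero → ≤-refl }
  argmax {suc K} v with argmax (v ∘ suc)
  ... | m , max with ≤-total (v zero) (v (suc m))
  ...   | inj₁ v₀≤ = suc m , λ { zero → v₀≤ ; (suc i) → max i }
  ...   | inj₂ ≤v₀ = zero  , λ { zero → ≤-refl ; (suc i) → ≤-trans (max i) ≤v₀ }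

sorting : ∀ {K} (v : Vector ℚᵘ K) →
          Σ (Permutation′ K) λ σ → Nonincreasing (v ∘ (σ ⟨$⟩ʳ_))
sorting {zero}  v = Perm.id , λ { {()} }
sorting {suc K} v with argmax v
... | m , max with sorting (v ∘ punchIn m)
...   | π , mono = σ , mono′
  where
  σ : Permutation′ (suc K)
  σ = Perm.insert zero m π

  σ-suc : ∀ i → σ ⟨$⟩ʳ suc i ≡ punchIn m (π ⟨$⟩ʳ i)
  σ-suc = Perm.insert-punchIn zero m π

  mono′ : Nonincreasing (v ∘ (σ ⟨$⟩ʳ_))
  mono′ {zero}  {j}     _           = max (σ ⟨$⟩ʳ j)
  mono′ {suc i} {suc j} (ℕ.s≤s i≤j) =
    subst₂ (λ k l → v k ≤ v l) (sym (σ-suc j)) (sym (σ-suc i)) (mono i≤j)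

-- The value does not depend on which sorting permutation is used.
owa : ∀ {K} → WeightVector K → Vector ℚᵘ K → ℚᵘ
owa w v = Σℚ (λ j → weight w j * v (σ ⟨$⟩ʳ j))
  where σ = proj₁ (sorting v)

-- Costs are unnormalised fractions, so scenarios are compared up to _≃_.
ScenarioSet : ℕ → ℕ → Set
ScenarioSet K n = Σ (Vector (CostVector n) K) λ Γ →
  ∀ j k → j ≢ k → ¬ (∀ i → proj₁ (Γ j) i ≃ proj₁ (Γ k) i)

Min-Owa : CombinatorialProblem → ∀ {K} → WeightVector K → MinProblem
Min-Owa P {K} w = record
  { Instance  = Σ Structure λ S → ScenarioSet K (elements S)
  ; encode    = λ (S , Γ , _) → pair (encode S) (list (encodeCosts ∘ Γ))
  ; ground    = λ (S , _) → elements S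
  ; Feasible  = λ (S , _) → Φ S
  ; objective = λ (_ , Γ , _) X → owa w (λ j → F X (proj₁ (Γ j)))
  }
  where open CombinatorialProblem P

two-weights : (α : ℚᵘ) → 0ℚᵘ ≤ α → α ≤ ½ → WeightVector 2
two-weights α 0≤α α≤½ = record
  { weight   = α ∷ (1ℚᵘ - α) ∷ []
  ; weight≥0 = λ { zero → 0≤α ; (suc zero) → p≤q⇒0≤q-p α≤1 }
  ; weight≤1 = λ { zero → α≤1 ; (suc zero) → 1-α≤1 }
  ; weight-Σ = Σ≃1
  }
  where
  open ≤-Reasoning

  α≤1 : α ≤ 1ℚᵘ
  α≤1 = ≤-trans α≤½ (*≤* (+≤+ (ℕ.s≤s ℕ.z≤n)))

  1-α≤1 : 1ℚᵘ - α ≤ 1ℚᵘ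
  1-α≤1 = begin
    1ℚᵘ - α     ≤⟨ +-monoʳ-≤ 1ℚᵘ (neg-mono-≤ 0≤α) ⟩
    1ℚᵘ + 0ℚᵘ   ≃⟨ +-identityʳ 1ℚᵘ ⟩
    1ℚᵘ         ∎

  Σ≃1 : α + ((1ℚᵘ - α) + 0ℚᵘ) ≃ 1ℚᵘ
  Σ≃1 = begin-equality
    α + ((1ℚᵘ - α) + 0ℚᵘ)   ≃⟨ +-congʳ α (+-identityʳ (1ℚᵘ - α)) ⟩
    α + (1ℚᵘ - α)           ≃⟨ +-congʳ α (+-comm 1ℚᵘ (- α)) ⟩
    α + (- α + 1ℚᵘ)         ≃⟨ +-assoc α (- α) 1ℚᵘ ⟨
    (α - α) + 1ℚᵘ           ≃⟨ +-congˡ 1ℚᵘ (+-inverseʳ α) ⟩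
    0ℚᵘ + 1ℚᵘ               ≃⟨ +-identityˡ 1ℚᵘ ⟩
    1ℚᵘ                     ∎

{-# OPTIONS --safe #-}
module Submission where

-- Since w₁ ≤ w₂, putting the larger weight on the smaller of the two
-- scenario costs gives OWA(X) = min(F(X, a), F(X, b)) for the scalarized
-- costs a = w₁ c₁ + w₂ c₂ and b = w₂ c₁ + w₁ c₂.  So the better of an
-- optimum for a and an optimum for b minimizes OWA, and two calls of the
-- deterministic algorithm suffice.  Computing a, b and the two optimal
-- values are folds over lists; their cost is polynomial because the
-- unreduced fractions that occur have numerators and denominators whose
-- bit sizes grow only additively from one element to the next.

open import Defs
open import Data.Bool.Base using (Bool; true; false; if_then_else_; T)
open import Data.Fin.Base using (zero; suc)
open import Data.Fin.Permutation using (Permutation′; _⟨$⟩ʳ_)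
open import Data.Fin.Subset using (Subset)
import Data.Integer.Base as ℤ
import Data.Integer.Properties as ℤ
open import Data.List.Base using (List; []; _∷_; foldl; foldr; map; reverse; tabulate; _ʳ++_)
open import Data.List.Properties using (reverse-foldl)
open import Data.Maybe.Base using (Maybe; just; nothing)
open import Data.Nat.Base
open import Data.Nat.Logarithm
open import Data.Nat.Properties
open import Data.Nat.Tactic.RingSolver using (solve-∀)
open import Data.Product.Base using (Σ; ∃-syntax; _×_; _,_; proj₁; proj₂)
open import Data.Rational.Unnormalised.Base as ℚ using (ℚᵘ; mkℚᵘ; 0ℚᵘ; 1ℚᵘ; ½; *≤*)
import Data.Rational.Unnormalised.Properties as ℚ
open import Data.Rational.Unnormalised.Solver using (module +-*-Solver)
open import Data.Sum.Base using (_⊎_; inj₁; inj₂)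
open import Data.Vec.Base using (lookup; []; _∷_)
open import Data.Vec.Functional using (Vector)
open import Function.Base using (_∘_; id; flip)
open import Function.Bundles using (module Injection)
open import Function.Properties.Inverse using (↔⇒↣)
open import Relation.Binary.PropositionalEquality
open import Relation.Nullary using (¬_; contradiction)

-- Bit sizes

-- Otherwise monotonicity of the logarithm would give `size (nat n) ≤ ⌊log₂ n ⌋`, one less than
-- itself.
n<2^size : ∀ n → n < 2 ^ size (nat n)
n<2^size n = ≰⇒> λ 2^s≤n → 1+n≰n
  (subst (_≤ ⌊log₂ n ⌋) (⌊log₂[2^n]⌋≡n (size (nat n))) (⌊log₂⌋-mono-≤ 2^s≤n))

⌊n/2⌋< : ∀ {m n} → n < m + m → ⌊ n /2⌋ < m
⌊n/2⌋< {m} {n} n<2m = ≰⇒> λ m≤ → <⇒≱ n<2m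
  (subst (m + m ≤_) (⌊n/2⌋+⌈n/2⌉≡n n) (+-mono-≤ m≤ (≤-trans m≤ (⌊n/2⌋≤⌈n/2⌉ n))))

-- Halving lowers the logarithm by one, so induction on `k` applies. The exponent is a successor
-- because even 0 has size 1.
size≤ : ∀ k {n} → n < 2 ^ suc k → size (nat n) ≤ suc k
size≤ zero    {zero}        _ = ≤-refl
size≤ zero    {suc zero}    _ = ≤-refl
size≤ zero    {suc (suc _)} (s≤s (s≤s ()))
size≤ (suc k) {n}           n< = s≤s (begin
  ⌊log₂ n ⌋               ≤⟨ m≤n+m∸n ⌊log₂ n ⌋ 1 ⟩
  suc (⌊log₂ n ⌋ ∸ 1)     ≡⟨ cong suc (⌊log₂⌊n/2⌋⌋≡⌊log₂n⌋∸1 n) ⟨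
  size (nat ⌊ n /2⌋)      ≤⟨ size≤ k (⌊n/2⌋< (subst (λ x → n < 2 ^ suc k + x) (+-identityʳ _) n<)) ⟩
  suc k                   ∎)
  where open ≤-Reasoning

size-mono : ∀ {m n} → m ≤ n → size (nat m) ≤ size (nat n)
size-mono m≤n = s≤s (⌊log₂⌋-mono-≤ m≤n)

size-* : ∀ m n → size (nat (m * n)) ≤ size (nat m) + size (nat n)
size-* m n = size≤ (⌊log₂ m ⌋ + size (nat n)) (begin-strict
  m * n                                  <⟨ *-mono-< (n<2^size m) (n<2^size n) ⟩
  2 ^ size (nat m) * 2 ^ size (nat n)    ≡⟨ ^-distribˡ-+-* 2 (size (nat m)) (size (nat n)) ⟨
  2 ^ (size (nat m) + size (nat n))      ∎)
  where open ≤-Reasoning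

-- Adding `m * n` makes the successor factor as `suc m * suc n`, and each factor is at most a power
-- of two.
size-+ : ∀ m n → size (nat (m + n)) ≤ size (nat m) + size (nat n)
size-+ m n = begin
  size (nat (m + n))              ≤⟨ size-mono (m≤m+n (m + n) (m * n)) ⟩
  size (nat (m + n + m * n))      ≤⟨ size≤ (⌊log₂ m ⌋ + size (nat n)) below ⟩
  size (nat m) + size (nat n)     ∎
  where
  open ≤-Reasoning

  below : m + n + m * n < 2 ^ (size (nat m) + size (nat n))
  below = begin
    suc (m + n + m * n)                    ≡⟨ expand m n ⟩
    suc m * suc n                          ≤⟨ *-mono-≤ (n<2^size m) (n<2^size n) ⟩
    2 ^ size (nat m) * 2 ^ size (nat n)    ≡⟨ ^-distribˡ-+-* 2 (size (nat m)) (size (nat n)) ⟨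
    2 ^ (size (nat m) + size (nat n))      ∎
    where
    expand : ∀ a b → suc (a + b + a * b) ≡ suc a * suc b
    expand = solve-∀

size-num : ∀ x → size (nat (num x)) ≤ size x
size-num (nat _)    = ≤-refl
size-num (pair _ _) = s≤s z≤n

1≤size : ∀ x → 1 ≤ size x
1≤size (nat _)    = s≤s z≤n
1≤size (pair _ _) = s≤s z≤n

-- Every run first feeds its input to some primitive, which is charged for it. `output≤cost` relies
-- on this for a loop that stops at once and returns its input.
input≤cost : ∀ {p x y t} → p ⊢ x ⇓ y [ t ] → size x ≤ t
input≤cost run-prim            = m≤m+n _ _
input≤cost (run-⨾ r _)         = m≤n⇒m≤n+o _ (input≤cost r)
input≤cost (run-fork r _)      = m≤n⇒m≤1+n (m≤n⇒m≤n+o _ (input≤cost r))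
input≤cost (run-then r _ _)    = m≤n⇒m≤1+n (m≤n⇒m≤n+o _ (input≤cost r))
input≤cost (run-else r _)      = m≤n⇒m≤1+n (m≤n⇒m≤n+o _ (input≤cost r))
input≤cost (run-stop r)        = m≤n⇒m≤1+n (input≤cost r)
input≤cost (run-again r _ _ _) = m≤n⇒m≤1+n (m≤n⇒m≤n+o _ (m≤n⇒m≤n+o _ (input≤cost r)))

-- Time bounds thereby double as size bounds for the intermediate values of a composition.
output≤cost : ∀ {p x y t} → p ⊢ x ⇓ y [ t ] → size y ≤ t
output≤cost run-prim            = m≤n+m _ _
output≤cost (run-⨾ _ r)         = m≤n⇒m≤o+n _ (output≤cost r)
output≤cost (run-fork r s)      = s≤s (+-mono-≤ (output≤cost r) (output≤cost s))
output≤cost (run-then _ _ r)    = m≤n⇒m≤1+n (m≤n⇒m≤o+n _ (output≤cost r))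
output≤cost (run-else _ r)      = m≤n⇒m≤1+n (m≤n⇒m≤o+n _ (output≤cost r))
output≤cost (run-stop r)        = m≤n⇒m≤1+n (input≤cost r)
output≤cost (run-again _ _ _ r) = m≤n⇒m≤1+n (m≤n⇒m≤o+n _ (output≤cost r))

-- Linear time

-- The unit overhead of `fork`, `branch` and loops is absorbed by one more multiple of the positive
-- number `n`.
suc-+-bound : ∀ {s t n} k l → s ≤ k * n → t ≤ l * n → 1 ≤ n → suc (s + t) ≤ suc (k + l) * n
suc-+-bound {n = n} k l s≤ t≤ 1≤n =
  +-mono-≤ 1≤n (≤-trans (+-mono-≤ s≤ t≤) (≤-reflexive (sym (*-distribʳ-+ n k l))))

-- Only inputs of the form i x matter: the program may diverge elsewhere.
record LinTime {D : Set} (i o : D → Val) : Set where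
  field
    program : Prog
    factor  : ℕ
    run     : ∀ x → ∃[ t ] program ⊢ i x ⇓ o x [ t ] × t ≤ factor * size (i x)

  output≤ : ∀ x → size (o x) ≤ factor * size (i x)
  output≤ x = let _ , r , t≤ = run x in ≤-trans (output≤cost r) t≤

restrict : ∀ {D E : Set} {j o : E → Val} → LinTime j o → (g : D → E) → LinTime (j ∘ g) (o ∘ g)
restrict L g = record { program = program ; factor = factor ; run = run ∘ g }
  where open LinTime L

module _ {D : Set} {i : D → Val} where

  after : ∀ {m o : D → Val} → LinTime i m → LinTime m o → LinTime i o
  after {m} L M = record
    { program = L.program ⨾ M.program
    ; factor  = L.factor + M.factor * L.factor
    ; run     = λ x → let _ , r , s≤ = L.run x ; _ , r′ , t≤ = M.run x in
                _ , run-⨾ r r′ , bound s≤ t≤ (L.output≤ x)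
    }
    where
    module L = LinTime L
    module M = LinTime M
    bound : ∀ {s t n p} → s ≤ L.factor * n → t ≤ M.factor * p → p ≤ L.factor * n →
            s + t ≤ (L.factor + M.factor * L.factor) * n
    bound {s} {t} {n} {p} s≤ t≤ p≤ = begin
      s + t                                        ≤⟨ +-mono-≤ s≤ t≤ ⟩
      L.factor * n + M.factor * p                  ≤⟨ +-monoʳ-≤ (L.factor * n) (*-monoʳ-≤ M.factor p≤) ⟩
      L.factor * n + M.factor * (L.factor * n)     ≡⟨ cong (L.factor * n +_) (*-assoc M.factor L.factor n) ⟨
      L.factor * n + M.factor * L.factor * n       ≡⟨ *-distribʳ-+ n L.factor _ ⟨
      (L.factor + M.factor * L.factor) * n         ∎
      where open ≤-Reasoning

  here : LinTime i i
  here = record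
    { program = prim copy
    ; factor  = 2
    ; run     = λ x → _ , run-prim , ≤-reflexive (cong (size (i x) +_) (sym (+-identityʳ _)))
    }

  basic : ∀ f k → (∀ x → size (eval f x) ≤ k * size x) →
          ∀ {o : D → Val} → LinTime i o → LinTime i (eval f ∘ o)
  basic f k size≤k {o} L = after L (record
    { program = prim f
    ; factor  = suc k
    ; run     = λ x → _ , run-prim , +-monoʳ-≤ (size (o x)) (size≤k (o x))
    })

  pairing : ∀ {u v : D → Val} → LinTime i u → LinTime i v → LinTime i (λ x → pair (u x) (v x))
  pairing L M = record
    { program = fork L.program M.program
    ; factor  = suc (L.factor + M.factor)
    ; run     = λ x → let _ , r , s≤ = L.run x ; _ , r′ , t≤ = M.run x in
                _ , run-fork r r′ , suc-+-bound L.factor M.factor s≤ t≤ (1≤size (i x))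
    }
    where
    module L = LinTime L
    module M = LinTime M

  lefts : ∀ {o : D → Val} → LinTime i o → LinTime i (eval left ∘ o)
  lefts = basic left 1 λ where
    (nat k)    → s≤s z≤n
    (pair x y) → ≤-trans (m≤n⇒m≤1+n (m≤m+n (size x) (size y))) (m≤m+n _ 0)

  rights : ∀ {o : D → Val} → LinTime i o → LinTime i (eval right ∘ o)
  rights = basic right 1 λ where
    (nat k)    → s≤s z≤n
    (pair x y) → ≤-trans (m≤n⇒m≤1+n (m≤n+m (size y) (size x))) (m≤m+n _ 0)

  isPairs : ∀ {o : D → Val} → LinTime i o → LinTime i (eval isPair ∘ o)
  isPairs = basic isPair 1 λ { (nat k) → s≤s z≤n ; (pair x y) → s≤s z≤n }

  constant : ∀ k → LinTime i (λ _ → nat k)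
  constant k = basic (const k) (size (nat k)) (λ x → m≤m*n (size (nat k)) (size x) ⦃ >-nonZero (1≤size x) ⦄) here

  -- Bounding the bits of `g m n` suffices, since reading a value through `num` never increases its
  -- size.
  arithmetic : ∀ f g → (∀ x → eval f x ≡ arith g x) →
               (∀ m n → size (nat (g m n)) ≤ size (nat m) + size (nat n)) →
               ∀ {u v : D → Val} → LinTime i u → LinTime i v →
               LinTime i (λ x → eval f (pair (u x) (v x)))
  arithmetic f g eq size≤+ L M = basic f 1
    (λ x → ≤-trans (subst (λ y → size y ≤ size x) (sym (eq x)) (bound x)) (m≤m+n _ 0)) (pairing L M)
    where
    bound : ∀ x → size (arith g x) ≤ size x
    bound (nat _)    = s≤s z≤n
    bound (pair x y) = m≤n⇒m≤1+n (≤-trans (size≤+ (num x) (num y)) (+-mono-≤ (size-num x) (size-num y)))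

  _⊕_ : ∀ {u v : D → Val} → LinTime i u → LinTime i v → LinTime i (λ x → nat (num (u x) + num (v x)))
  _⊕_ = arithmetic add _+_ (λ _ → refl) size-+

  _⊗_ : ∀ {u v : D → Val} → LinTime i u → LinTime i v → LinTime i (λ x → nat (num (u x) * num (v x)))
  _⊗_ = arithmetic mul _*_ (λ _ → refl) size-*

  _⊴_ : ∀ {u v : D → Val} → LinTime i u → LinTime i v → LinTime i (λ x → bit (num (u x) ≤ᵇ num (v x)))
  _⊴_ = arithmetic leq (λ m n → if m ≤ᵇ n then 1 else 0) (λ _ → refl) bound
    where
    bound : ∀ m n → size (bit (m ≤ᵇ n)) ≤ size (nat m) + size (nat n)
    bound m n with m ≤ᵇ n
    ... | true  = s≤s z≤n
    ... | false = s≤s z≤n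

-- The effect of `branch` as a total function: only `nat 0` counts as false, as in `run-then` and
-- `run-else`.
choose : Val → Val → Val → Val
choose (nat zero)    _ v = v
choose (nat (suc _)) u _ = u
choose (pair _ _)    u _ = u

conditional : ∀ {D : Set} {i c u v : D → Val} → LinTime i c → LinTime i u → LinTime i v →
              LinTime i (λ x → choose (c x) (u x) (v x))
conditional {i = i} {c} {u} {v} C L M = record
  { program = branch C.program L.program M.program
  ; factor  = suc (C.factor + (L.factor + M.factor))
  ; run     = λ x → let _ , r , s≤ = C.run x in halt x (c x) r s≤
  }
  where
  module C = LinTime C
  module L = LinTime L
  module M = LinTime M

  -- The test result `c x` is generalized to `b`, so that matching on it reduces `choose` and
  -- selects the rule.
  halt : ∀ x b {s} → C.program ⊢ i x ⇓ b [ s ] → s ≤ C.factor * size (i x) →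
         ∃[ t ] branch C.program L.program M.program ⊢ i x ⇓ choose b (u x) (v x) [ t ]
                × t ≤ suc (C.factor + (L.factor + M.factor)) * size (i x)
  halt x b r s≤ with L.run x | M.run x
  halt x (nat zero)    r s≤ | _ | _ , r′ , t≤ = _ , run-else r r′ ,
    suc-+-bound C.factor _ s≤ (≤-trans t≤ (*-monoˡ-≤ _ (m≤n+m _ L.factor))) (1≤size (i x))
  halt x (nat (suc _)) r s≤ | _ , r′ , t≤ | _ = _ , run-then r (λ ()) r′ ,
    suc-+-bound C.factor _ s≤ (≤-trans t≤ (*-monoˡ-≤ _ (m≤m+n L.factor _))) (1≤size (i x))
  halt x (pair _ _)    r s≤ | _ , r′ , t≤ | _ = _ , run-then r (λ ()) r′ ,
    suc-+-bound C.factor _ s≤ (≤-trans t≤ (*-monoˡ-≤ _ (m≤m+n L.factor _))) (1≤size (i x))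

-- Polynomial time

record PolyTime {D : Set} (i o : D → Val) : Set where
  field
    program : Prog
    factor  : ℕ
    degree  : ℕ
    run     : ∀ x → ∃[ t ] program ⊢ i x ⇓ o x [ t ] × t ≤ factor * size (i x) ^ degree

poly : ∀ {D : Set} {i o : D → Val} → LinTime i o → PolyTime i o
poly {i = i} L = record
  { program = program
  ; factor  = factor
  ; degree  = 1
  ; run     = λ x → let _ , r , t≤ = run x in
              _ , r , ≤-trans t≤ (≤-reflexive (cong (factor *_) (sym (^-identityʳ (size (i x))))))
  }
  where open LinTime L

restrictₚ : ∀ {D E : Set} {j o : E → Val} → PolyTime j o → (g : D → E) → PolyTime (j ∘ g) (o ∘ g)
restrictₚ L g = record { program = program ; factor = factor ; degree = degree ; run = run ∘ g }
  where open PolyTime L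

^-raise : ∀ {n} → 1 ≤ n → ∀ d e → n ^ d ≤ n ^ (d + e)
^-raise {n} 1≤n d e = ^-monoʳ-≤ n ⦃ >-nonZero 1≤n ⦄ (m≤m+n d e)

*-distrib-^ : ∀ m n e → (m * n) ^ e ≡ m ^ e * n ^ e
*-distrib-^ m n zero    = refl
*-distrib-^ m n (suc e) = trans (cong (m * n *_) (*-distrib-^ m n e)) (interchange m n (m ^ e) (n ^ e))
  where
  interchange : ∀ a b c d → a * b * (c * d) ≡ a * c * (b * d)
  interchange = solve-∀

-- Monomial bounds compose: the second program sees an input of size at most `a * n ^ d` and so
-- takes time at most `b * a ^ e * n ^ (d * e)`.
afterₚ : ∀ {D : Set} {i m o : D → Val} → PolyTime i m → PolyTime m o → PolyTime i o
afterₚ {i = i} {m} {o} L M = record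
  { program = L.program ⨾ M.program
  ; factor  = L.factor + M.factor * L.factor ^ M.degree
  ; degree  = L.degree + L.degree * M.degree
  ; run     = λ x → let _ , r , s≤ = L.run x ; _ , r′ , t≤ = M.run x in
              _ , run-⨾ r r′ , bound (1≤size (i x)) s≤ t≤ (≤-trans (output≤cost r) s≤)
  }
  where
  module L = PolyTime L
  module M = PolyTime M
  bound : ∀ {s t n p} → 1 ≤ n → s ≤ L.factor * n ^ L.degree → t ≤ M.factor * p ^ M.degree →
          p ≤ L.factor * n ^ L.degree →
          s + t ≤ (L.factor + M.factor * L.factor ^ M.degree) * n ^ (L.degree + L.degree * M.degree)
  bound {s} {t} {n} {p} 1≤n s≤ t≤ p≤ = begin
    s + t
      ≤⟨ +-mono-≤ s≤ t≤ ⟩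
    a * n ^ d + b * p ^ e
      ≤⟨ +-monoʳ-≤ (a * n ^ d) (*-monoʳ-≤ b (^-monoˡ-≤ e p≤)) ⟩
    a * n ^ d + b * (a * n ^ d) ^ e
      ≡⟨ cong (λ y → a * n ^ d + b * y) (*-distrib-^ a (n ^ d) e) ⟩
    a * n ^ d + b * (a ^ e * (n ^ d) ^ e)
      ≡⟨ cong (λ y → a * n ^ d + b * (a ^ e * y)) (^-*-assoc n d e) ⟩
    a * n ^ d + b * (a ^ e * n ^ (d * e))
      ≡⟨ cong (a * n ^ d +_) (*-assoc b (a ^ e) (n ^ (d * e))) ⟨
    a * n ^ d + b * a ^ e * n ^ (d * e)
      -- Both exponents are raised to the common upper bound `d + d * e`, which is sound as `1 ≤ n`.
      ≤⟨ +-mono-≤ (*-monoʳ-≤ a (^-raise 1≤n d (d * e)))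
           (*-monoʳ-≤ (b * a ^ e) (subst (λ y → n ^ (d * e) ≤ n ^ y) (+-comm (d * e) d) (^-raise 1≤n (d * e) d))) ⟩
    a * n ^ (d + d * e) + b * a ^ e * n ^ (d + d * e)
      ≡⟨ *-distribʳ-+ (n ^ (d + d * e)) a (b * a ^ e) ⟨
    (a + b * a ^ e) * n ^ (d + d * e)
      ∎
    where
    open ≤-Reasoning
    a = L.factor
    b = M.factor
    d = L.degree
    e = M.degree

pairingₚ : ∀ {D : Set} {i u v : D → Val} → PolyTime i u → PolyTime i v →
           PolyTime i (λ x → pair (u x) (v x))
pairingₚ {i = i} L M = record
  { program = fork L.program M.program
  ; factor  = suc (L.factor + M.factor)
  ; degree  = L.degree + M.degree
  ; run     = λ x → let _ , r , s≤ = L.run x ; _ , r′ , t≤ = M.run x ; 1≤n = 1≤size (i x) in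
              _ , run-fork r r′ , suc-+-bound L.factor M.factor
                (≤-trans s≤ (*-monoʳ-≤ L.factor (^-raise 1≤n L.degree M.degree)))
                (≤-trans t≤ (*-monoʳ-≤ M.factor (subst (λ y → size (i x) ^ M.degree ≤ size (i x) ^ y)
                  (+-comm M.degree L.degree) (^-raise 1≤n M.degree L.degree))))
                (m^n>0 (size (i x)) ⦃ >-nonZero 1≤n ⦄ (L.degree + M.degree))
  }
  where
  module L = PolyTime L
  module M = PolyTime M

-- Loops over lists

encodeList : List Val → Val
encodeList []       = nat 0
encodeList (v ∷ vs) = pair v (encodeList vs)

-- If every step adds at most linearly in the consumed element to the
-- potential μ, then Φ does not increase along the loop and bounds the
-- size of every intermediate state.
module Fold {A : Set} (e : A → Val) (f : A → Val → A)
            (step : LinTime {D = A × Val} (λ (a , v) → pair v (e a)) (λ (a , v) → e (f a v)))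
            (μ : A → ℕ) (k : ℕ)
            (μ-step : ∀ a v → μ (f a v) ≤ μ a + k * size v)
            (size≤μ : ∀ a → size (e a) ≤ k * μ a)
            (μ≤size : ∀ a → μ a ≤ size (e a))
            where

  state : List Val × A → Val
  state (l , a) = pair (encodeList l) (e a)

  Φ : List Val × A → ℕ
  Φ (l , a) = suc (suc (k * k) * size (encodeList l) + k * μ a)

  size≤Φ : ∀ x → size (state x) ≤ Φ x
  size≤Φ (l , a) = s≤s (+-mono-≤ (m≤m+n _ _) (size≤μ a))

  -- Consuming `v` frees `suc (k * k) * suc (size v)`, while `k * μ` grows by at most
  -- `k * k * size v`. The difference is the slack `suc (size v + k * k)`.
  Φ-step : ∀ v l a → Φ (l , f a v) ≤ Φ (v ∷ l , a)
  Φ-step v l a = s≤s (begin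
    suc (k * k) * L + k * μ (f a v)                        ≤⟨ +-monoʳ-≤ (suc (k * k) * L) (*-monoʳ-≤ k (μ-step a v)) ⟩
    suc (k * k) * L + k * (μ a + k * size v)               ≤⟨ m≤n+m _ (suc (size v + k * k)) ⟩
    suc (size v + k * k) + (suc (k * k) * L + k * (μ a + k * size v))
      ≡⟨ rearrange k L (size v) (μ a) ⟩
    suc (k * k) * suc (size v + L) + k * μ a               ∎)
    where
    open ≤-Reasoning
    L = size (encodeList l)
    rearrange : ∀ k L s m → suc (s + k * k) + (suc (k * k) * L + k * (m + k * s)) ≡
                            suc (k * k) * suc (s + L) + k * m
    rearrange = solve-∀

  test : LinTime state (λ (l , _) → eval isPair (encodeList l))
  test = isPairs (lefts here)

  body : LinTime {D = Val × List Val × A} (λ (v , l , a) → state (v ∷ l , a)) (λ (v , l , a) → state (l , f a v))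
  body = pairing (rights (lefts here))
                 -- The head of the list and the accumulator are regrouped into the input format of
                 -- `step`.
                 (after (pairing (lefts (lefts here)) (rights here)) (restrict step (λ (v , _ , a) → a , v)))

  module test = LinTime test
  module body = LinTime body

  K : ℕ
  K = suc (test.factor + body.factor)

  -- A fixed `N` bounds every state, so each round costs at most `K * N`, and the size of the
  -- encoded list bounds the number of tests.
  iterate : ∀ l a N → Φ (l , a) ≤ N → ∃[ t ]
         (while test.program loop body.program) ⊢ state (l , a) ⇓ state ([] , foldl f a l) [ t ]
         × t ≤ size (encodeList l) * (K * N)
  iterate [] a N Φ≤ = let _ , r , s≤ = test.run ([] , a) in
    _ , run-stop r ,
    -- The final test is charged as a round whose body takes time 0; the size 1 of the encoded empty
    -- list pays for it.
    subst₂ _≤_ (cong suc (+-identityʳ _)) (sym (+-identityʳ (K * N)))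
      (suc-+-bound test.factor body.factor
        (≤-trans s≤ (*-monoʳ-≤ test.factor (≤-trans (size≤Φ ([] , a)) Φ≤))) z≤n (≤-trans (s≤s z≤n) Φ≤))
  iterate (v ∷ l) a N Φ≤ =
    let _ , r , s≤ = test.run (v ∷ l , a)
        _ , r′ , t≤ = body.run (v , l , a)
        _ , r″ , u≤ = iterate l (f a v) N (≤-trans (Φ-step v l a) Φ≤)
        state≤ = ≤-trans (size≤Φ (v ∷ l , a)) Φ≤
    in _ , run-again r (λ ()) r′ r″ ,
       +-mono-≤ (suc-+-bound test.factor body.factor
                  (≤-trans s≤ (*-monoʳ-≤ test.factor state≤)) (≤-trans t≤ (*-monoʳ-≤ body.factor state≤))
                  (≤-trans (s≤s z≤n) Φ≤))
                (≤-trans u≤ (*-monoˡ-≤ (K * N) (m≤n+m (size (encodeList l)) (size v))))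

  C : ℕ
  C = suc (suc (k * k) + k)

  Φ≤size : ∀ x → Φ x ≤ C * size (state x)
  Φ≤size x@(l , a) = suc-+-bound (suc (k * k)) k
    (*-monoʳ-≤ (suc (k * k)) (m≤n⇒m≤1+n (m≤m+n _ _)))
    (*-monoʳ-≤ k (≤-trans (μ≤size a) (m≤n⇒m≤1+n (m≤n+m _ _))))
    (1≤size (state x))

  foldₚ : PolyTime state (λ (l , a) → e (foldl f a l))
  foldₚ = afterₚ {m = λ (l , a) → state ([] , foldl f a l)} (record
    { program = while test.program loop body.program
    -- With inputs of size `n` there are at most `n` rounds of cost `K * (C * n)`, hence degree 2.
    ; factor  = K * C
    ; degree  = 2
    ; run     = λ x@(l , a) → let _ , r , t≤ = iterate l a _ (Φ≤size x) in
                _ , r , ≤-trans t≤ (bound (m≤n⇒m≤1+n (m≤m+n (size (encodeList l)) (size (e a)))))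
    }) (poly (rights here))
    where
    bound : ∀ {s n} → s ≤ n → s * (K * (C * n)) ≤ K * C * n ^ 2
    bound {s} {n} s≤n = ≤-trans (*-monoˡ-≤ _ s≤n) (≤-reflexive (rearrange n K C))
      where
      rearrange : ∀ n k c → n * (k * (c * n)) ≡ k * c * (n * (n * 1))
      rearrange = solve-∀

-- Transports a time bound between equal encodings, such as `list` of a vector and `encodeList` of
-- its tabulation.
castₚ : ∀ {D : Set} {i i′ o o′ : D → Val} → (∀ x → i x ≡ i′ x) → (∀ x → o x ≡ o′ x) →
        PolyTime i o → PolyTime i′ o′
castₚ i≡ o≡ L = record
  { program = program
  ; factor  = factor
  ; degree  = degree
  ; run     = λ x → let t , r , t≤ = run x in
              t , subst₂ (λ u v → program ⊢ u ⇓ v [ t ]) (i≡ x) (o≡ x) r ,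
              subst (λ u → t ≤ factor * size u ^ degree) (i≡ x) t≤
  }
  where open PolyTime L

cast : ∀ {D : Set} {i o o′ : D → Val} → (∀ x → o x ≡ o′ x) → LinTime i o → LinTime i o′
cast o≡ L = record
  { program = program
  ; factor  = factor
  ; run     = λ x → let t , r , t≤ = run x in
              t , subst (λ v → program ⊢ _ ⇓ v [ t ]) (o≡ x) r , t≤
  }
  where open LinTime L

-- Padding makes the algorithm uniform: the right component of the answer
-- nothing is nat 0, which is read as an empty list of bits.
zipPad : List Val → List Val → List Val
zipPad []       _        = []
zipPad (v ∷ vs) []       = pair v (nat 0) ∷ zipPad vs []
zipPad (v ∷ vs) (w ∷ ws) = pair v w ∷ zipPad vs ws

zipStep : List Val × List Val → Val → List Val × List Val
zipStep ([]     , acc) v = [] , pair v (nat 0) ∷ acc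
zipStep (w ∷ ws , acc) v = ws , pair v w ∷ acc

foldl-zipStep : ∀ vs ws acc → proj₂ (foldl zipStep (ws , acc) vs) ≡ zipPad vs ws ʳ++ acc
foldl-zipStep []       ws       acc = refl
foldl-zipStep (v ∷ vs) []       acc = foldl-zipStep vs [] _
foldl-zipStep (v ∷ vs) (w ∷ ws) acc = foldl-zipStep vs ws _

-- A loop that pushes its results reverses them. The reversal is kept here, because the following
-- pass, `reverse-mapₚ` or `reverse-totalₚ`, starts from a reversed list.
reverse-zipₚ : PolyTime {D = List Val × List Val} (λ (vs , ws) → pair (encodeList vs) (encodeList ws))
                        (λ (vs , ws) → encodeList (reverse (zipPad vs ws)))
-- The added constant 0 encodes the empty accumulator.
reverse-zipₚ = afterₚ (poly (pairing (lefts here) (pairing (rights here) (constant 0))))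
  (afterₚ (restrictₚ foldₚ (λ (vs , ws) → vs , ws , []))
    (castₚ (λ _ → refl) (λ (vs , ws) → cong encodeList (foldl-zipStep vs ws [])) (poly (rights here))))
  where
  e : List Val × List Val → Val
  e (ws , acc) = pair (encodeList ws) (encodeList acc)

  step : LinTime {D = (List Val × List Val) × Val} (λ (a , v) → pair v (e a)) (λ (a , v) → e (zipStep a v))
  -- Both components of `nat 0` are `nat 0`, so one straight-line program realizes both clauses of
  -- `zipStep`.
  step = cast (λ { (([] , _) , _) → refl ; ((_ ∷ _ , _) , _) → refl })
    (pairing (rights (lefts (rights here)))
      (pairing (pairing (lefts here) (lefts (lefts (rights here)))) (rights (rights here))))

  -- When `ws` is nonempty, `w` only moves between the lists. Padding is the worse case: it adds
  -- `3 + size v`, which is at most `4 * size v`.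
  growth : ∀ a v → size (e (zipStep a v)) ≤ size (e a) + 4 * size v
  growth ([] , acc) v = begin
    3 + suc (size v + 1 + size (encodeList acc))             ≡⟨ shuffle (size v) _ ⟩
    (2 + size (encodeList acc)) + (3 + size v)               ≤⟨ +-monoʳ-≤ (2 + size (encodeList acc)) (+-monoˡ-≤ (size v) (*-monoʳ-≤ 3 (1≤size v))) ⟩
    (2 + size (encodeList acc)) + (3 * size v + size v)      ≡⟨ cong ((2 + size (encodeList acc)) +_) (+-comm (3 * size v) (size v)) ⟩
    (2 + size (encodeList acc)) + 4 * size v                 ∎
    where
    open ≤-Reasoning
    shuffle : ∀ s t → 3 + suc (s + 1 + t) ≡ (2 + t) + (3 + s)
    shuffle = solve-∀
  growth (w ∷ ws , acc) v = begin
    suc (W + suc (suc (size v + size w) + A))               ≡⟨ shuffle W (size v) (size w) A ⟩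
    suc (suc (size w + W) + A) + (1 + size v)               ≤⟨ +-monoʳ-≤ _ (+-monoˡ-≤ (size v) (1≤size v)) ⟩
    suc (suc (size w + W) + A) + (size v + size v)          ≤⟨ +-monoʳ-≤ (suc (suc (size w + W) + A)) (+-monoʳ-≤ (size v) (m≤m+n (size v) (2 * size v))) ⟩
    suc (suc (size w + W) + A) + 4 * size v                 ∎
    where
    open ≤-Reasoning
    W = size (encodeList ws)
    A = size (encodeList acc)
    shuffle : ∀ W v w A → suc (W + suc (suc (v + w) + A)) ≡ suc (suc (w + W) + A) + (1 + v)
    shuffle = solve-∀

  open Fold e zipStep step (size ∘ e) 4 growth (λ a → m≤m+n (size (e a)) _) (λ _ → ≤-refl)

-- A left fold over the reversed list is a right fold over the original, so pushing restores the
-- order.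
reverse-mapₚ : ∀ {g} → LinTime id g →
               PolyTime (encodeList ∘ reverse) (encodeList ∘ map g)
reverse-mapₚ {g} L = afterₚ (poly (pairing here (constant 0)))
  (castₚ (λ _ → refl) (λ vs → cong encodeList (correct vs)) (restrictₚ foldₚ (λ vs → reverse vs , [])))
  where
  open LinTime L using (factor; output≤)

  push : List Val → Val → List Val
  push acc v = g v ∷ acc

  correct : ∀ vs → foldl push [] (reverse vs) ≡ map g vs
  correct vs = trans (reverse-foldl push [] vs) (foldr-push vs)
    where
    foldr-push : ∀ vs → foldr (flip push) [] vs ≡ map g vs
    foldr-push []       = refl
    foldr-push (v ∷ vs) = cong (g v ∷_) (foldr-push vs)

  growth : ∀ acc v → size (encodeList (push acc v)) ≤ size (encodeList acc) + suc factor * size v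
  growth acc v = begin
    suc (size (g v) + A)         ≡⟨ cong suc (+-comm (size (g v)) A) ⟩
    suc (A + size (g v))         ≡⟨ +-suc A (size (g v)) ⟨
    A + suc (size (g v))         ≤⟨ +-monoʳ-≤ A (+-mono-≤ (1≤size v) (output≤ v)) ⟩
    A + suc factor * size v      ∎
    where
    open ≤-Reasoning
    A = size (encodeList acc)

  step : LinTime {D = List Val × Val} (λ (acc , v) → pair v (encodeList acc)) (λ (acc , v) → encodeList (push acc v))
  step = pairing (after (lefts here) (restrict L proj₂)) (rights here)

  open Fold encodeList push step
    (size ∘ encodeList) (suc factor) growth (λ a → m≤m+n _ _) (λ _ → ≤-refl)

-- Encoded fractions

numerator denominator : Val → ℕ
numerator   v = num (eval left v)
denominator v = num (eval right v)

infixl 6 _+ᵥ_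
infixl 7 _*ᵥ_

-- Nothing is reduced to lowest terms, just as in `ℚᵘ`; therefore the encodings of nonnegative
-- results agree as values, not merely up to `≃`.
_+ᵥ_ _*ᵥ_ : Val → Val → Val
u +ᵥ v = pair (nat (numerator u * denominator v + numerator v * denominator u))
              (nat (denominator u * denominator v))
u *ᵥ v = pair (nat (numerator u * numerator v)) (nat (denominator u * denominator v))

module _ {D : Set} {i u v : D → Val} (L : LinTime i u) (M : LinTime i v) where

  sums : LinTime i (λ x → u x +ᵥ v x)
  sums = pairing ((lefts L ⊗ rights M) ⊕ (lefts M ⊗ rights L)) (rights L ⊗ rights M)

  products : LinTime i (λ x → u x *ᵥ v x)
  products = pairing (lefts L ⊗ lefts M) (rights L ⊗ rights M)

constantℚ : ∀ {D : Set} {i : D → Val} q → LinTime i (λ _ → encodeℚ q)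
constantℚ q = pairing (constant _) (constant _)

-- Here `z` pairs a cost with a membership bit; an excluded element contributes the fraction 0/1.
selected : Val → Val
selected z = choose (eval right z) (eval left z) (encodeℚ 0ℚᵘ)

total : List Val → Val
total = foldr (λ z s → selected z +ᵥ s) (encodeℚ 0ℚᵘ)

-- Folding from the left over the reversed list follows the right-nested sum in `F`, starting from
-- 0/1.
reverse-totalₚ : PolyTime (encodeList ∘ reverse) total
reverse-totalₚ = afterₚ (poly (pairing here (constantℚ 0ℚᵘ)))
  (castₚ (λ _ → refl) correct (restrictₚ foldₚ (λ zs → reverse zs , (0 , 1))))
  where
  e : ℕ × ℕ → Val
  e (m , n) = pair (nat m) (nat n)

  accumulate : ℕ × ℕ → Val → ℕ × ℕ
  accumulate (m , n) z = (numerator t * n + m * denominator t , denominator t * n)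
    where t = selected z

  correct : ∀ zs → e (foldl accumulate (0 , 1) (reverse zs)) ≡ total zs
  correct zs = trans (cong e (reverse-foldl accumulate (0 , 1) zs)) (foldr-accumulate zs)
    where
    foldr-accumulate : ∀ zs → e (foldr (flip accumulate) (0 , 1) zs) ≡ total zs
    foldr-accumulate []       = refl
    foldr-accumulate (z ∷ zs) = cong (selected z +ᵥ_) (foldr-accumulate zs)

  selects : ∀ {D : Set} {i o : D → Val} → LinTime i o → LinTime i (selected ∘ o)
  selects L = conditional (rights L) (lefts L) (constantℚ 0ℚᵘ)

  -- Its `output≤` bounds the bits of the summand's numerator plus denominator linearly in `size z`,
  -- as `growth` requires.
  parts : LinTime id (λ z → nat (numerator (selected z) + denominator (selected z)))
  parts = lefts (selects here) ⊕ rights (selects here)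

  open LinTime parts using (factor; output≤)

  -- The sum of numerator and denominator is submultiplicative under
  -- addition of fractions, so its size grows additively.
  μ : ℕ × ℕ → ℕ
  μ (m , n) = size (nat (m + n))

  growth : ∀ a z → μ (accumulate a z) ≤ μ a + (3 + factor) * size z
  growth (m , n) z = begin
    -- The term `p * m` is the one missing from the expansion of `(m + n) * (p + q)`.
    size (nat (p * n + m * q + q * n))           ≤⟨ size-mono (m≤m+n (p * n + m * q + q * n) (p * m)) ⟩
    size (nat (p * n + m * q + q * n + p * m))   ≡⟨ cong (size ∘ nat) (factorize m n p q) ⟩
    size (nat ((m + n) * (p + q)))               ≤⟨ size-* (m + n) (p + q) ⟩
    size (nat (m + n)) + size (nat (p + q))      ≤⟨ +-monoʳ-≤ _ (≤-trans (output≤ z) (*-monoˡ-≤ (size z) (m≤n+m factor 3))) ⟩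
    size (nat (m + n)) + (3 + factor) * size z   ∎
    where
    open ≤-Reasoning
    p = numerator (selected z)
    q = denominator (selected z)
    factorize : ∀ m n p q → p * n + m * q + q * n + p * m ≡ (m + n) * (p + q)
    factorize = solve-∀

  -- Three copies of `μ a` cover the pair node, the numerator and the denominator.
  e≤μ : ∀ a → size (e a) ≤ (3 + factor) * μ a
  e≤μ a@(m , n) = ≤-trans
    (+-mono-≤ (1≤size (nat (m + n))) (+-mono-≤ (size-mono (m≤m+n m n)) (size-mono (m≤n+m n m))))
    (+-monoʳ-≤ (μ a) (+-monoʳ-≤ (μ a) (m≤m+n (μ a) _)))

  μ≤e : ∀ a → μ a ≤ size (e a)
  μ≤e (m , n) = m≤n⇒m≤1+n (size-+ m n)

  open Fold e accumulate (sums (selects (lefts here)) (rights here)) μ (3 + factor) growth e≤μ μ≤e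

-- Encodings of instances

tabulate-list : ∀ {n} (v : Vector Val n) → list v ≡ encodeList (tabulate v)
tabulate-list {zero}  v = refl
tabulate-list {suc n} v = cong (pair (v zero)) (tabulate-list (v ∘ suc))

map-zipPad : ∀ (g : Val → Val) {n} (u v : Vector Val n) →
             encodeList (map g (zipPad (tabulate u) (tabulate v))) ≡ list (λ i → g (pair (u i) (v i)))
map-zipPad g {zero}  u v = refl
map-zipPad g {suc n} u v = cong (pair _) (map-zipPad g (u ∘ suc) (v ∘ suc))

list-cong : ∀ {n} {u v : Vector Val n} → (∀ i → u i ≡ v i) → list u ≡ list v
list-cong {zero}  u≡v = refl
list-cong {suc n} u≡v = cong₂ pair (u≡v zero) (list-cong (u≡v ∘ suc))

+-nonneg : ∀ {p q} → 0ℚᵘ ℚ.≤ p → 0ℚᵘ ℚ.≤ q → 0ℚᵘ ℚ.≤ p ℚ.+ q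
+-nonneg 0≤p 0≤q = ℚ.+-mono-≤ 0≤p 0≤q

*-nonneg : ∀ {p q} → 0ℚᵘ ℚ.≤ p → 0ℚᵘ ℚ.≤ q → 0ℚᵘ ℚ.≤ p ℚ.* q
*-nonneg {p} {q} 0≤p 0≤q = ℚ.nonNegative⁻¹ (p ℚ.* q)
  ⦃ ℚ.nonNeg*nonNeg⇒nonNeg p ⦃ ℚ.nonNegative 0≤p ⦄ q ⦃ ℚ.nonNegative 0≤q ⦄ ⦄

encodeℚ-* : ∀ p q → encodeℚ (p ℚ.* q) ≡ encodeℚ p *ᵥ encodeℚ q
encodeℚ-* (mkℚᵘ m d) (mkℚᵘ n e) = cong (λ k → pair (nat k) (nat (suc d * suc e))) (ℤ.abs-* m n)

-- The encoding drops signs, and absolute values of nonnegative numerators add up. As an instance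
-- argument, nonnegativity leaves only the pattern `ℤ.+` to match.
encodeℚ-+ : ∀ {p q} → 0ℚᵘ ℚ.≤ p → 0ℚᵘ ℚ.≤ q → encodeℚ (p ℚ.+ q) ≡ encodeℚ p +ᵥ encodeℚ q
encodeℚ-+ {p} {q} 0≤p 0≤q = lemma p q ⦃ ℚ.nonNegative 0≤p ⦄ ⦃ ℚ.nonNegative 0≤q ⦄
  where
  lemma : ∀ p q → ⦃ ℚ.NonNegative p ⦄ → ⦃ ℚ.NonNegative q ⦄ → encodeℚ (p ℚ.+ q) ≡ encodeℚ p +ᵥ encodeℚ q
  lemma (mkℚᵘ (ℤ.+ m) d) (mkℚᵘ (ℤ.+ n) e) = cong (λ k → pair (nat k) (nat (suc d * suc e)))
    (cong₂ (λ i j → ℤ.∣ i ℤ.+ j ∣) (sym (ℤ.pos-* m (suc e))) (sym (ℤ.pos-* n (suc d))))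

cross-≤ : ∀ {p q} → 0ℚᵘ ℚ.≤ p → 0ℚᵘ ℚ.≤ q →
          numerator (encodeℚ p) * denominator (encodeℚ q) ≤ numerator (encodeℚ q) * denominator (encodeℚ p) →
          p ℚ.≤ q
cross-≤ {p} {q} 0≤p 0≤q = lemma p q ⦃ ℚ.nonNegative 0≤p ⦄ ⦃ ℚ.nonNegative 0≤q ⦄
  where
  lemma : ∀ p q → ⦃ ℚ.NonNegative p ⦄ → ⦃ ℚ.NonNegative q ⦄ →
          numerator (encodeℚ p) * denominator (encodeℚ q) ≤ numerator (encodeℚ q) * denominator (encodeℚ p) →
          p ℚ.≤ q
  lemma (mkℚᵘ (ℤ.+ m) d) (mkℚᵘ (ℤ.+ n) e) ≤ = *≤*
    (subst₂ ℤ._≤_ (ℤ.pos-* m (suc e)) (ℤ.pos-* n (suc d)) (ℤ.+≤+ ≤))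

-- Objective values

if-nonneg : ∀ b {p} → 0ℚᵘ ℚ.≤ p → 0ℚᵘ ℚ.≤ (if b then p else 0ℚᵘ)
if-nonneg true  0≤p = 0≤p
if-nonneg false _   = ℚ.≤-refl

F-nonneg : ∀ {n} (X : Subset n) ((c , _) : CostVector n) → 0ℚᵘ ℚ.≤ F X c
F-nonneg []      _         = ℚ.≤-refl
F-nonneg (b ∷ X) (c , c≥0) = +-nonneg (if-nonneg b (c≥0 zero)) (F-nonneg X (c ∘ suc , c≥0 ∘ suc))

total-F : ∀ {n} (X : Subset n) ((c , _) : CostVector n) →
          total (zipPad (tabulate (encodeℚ ∘ c)) (tabulate (bit ∘ lookup X))) ≡ encodeℚ (F X c)
total-F []      _         = refl
total-F (b ∷ X) (c , c≥0) = trans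
  (cong₂ _+ᵥ_ (selects b) (total-F X (c ∘ suc , c≥0 ∘ suc)))
  (sym (encodeℚ-+ (if-nonneg b (c≥0 zero)) (F-nonneg X (c ∘ suc , c≥0 ∘ suc))))
  where
  selects : ∀ b → selected (pair (encodeℚ (c zero)) (bit b)) ≡ encodeℚ (if b then c zero else 0ℚᵘ)
  selects true  = refl
  selects false = refl

-- Scalarized costs and OWA for two scenarios

combine : ∀ (α β : ℚᵘ) → 0ℚᵘ ℚ.≤ α → 0ℚᵘ ℚ.≤ β → ∀ {n} → CostVector n → CostVector n → CostVector n
combine α β 0≤α 0≤β (c , c≥0) (d , d≥0) =
  (λ i → α ℚ.* c i ℚ.+ β ℚ.* d i) , (λ i → +-nonneg (*-nonneg 0≤α (c≥0 i)) (*-nonneg 0≤β (d≥0 i)))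

F-linear : ∀ α β {n} (X : Subset n) (c d : Vector ℚᵘ n) →
           F X (λ i → α ℚ.* c i ℚ.+ β ℚ.* d i) ℚ.≃ α ℚ.* F X c ℚ.+ β ℚ.* F X d
F-linear α β []      c d = solve 2 (λ α β → con 0ℚᵘ := α :* con 0ℚᵘ :+ β :* con 0ℚᵘ) ℚ.≃-refl α β
  where open +-*-Solver
F-linear α β (b ∷ X) c d = ℚ.≃-trans
  (ℚ.+-cong (distributes b) (F-linear α β X (c ∘ suc) (d ∘ suc)))
  (solve 6 (λ α β p q r s → (α :* p :+ β :* q) :+ (α :* r :+ β :* s) := α :* (p :+ r) :+ β :* (q :+ s))
    ℚ.≃-refl α β _ _ _ _)
  where
  open +-*-Solver
  distributes : ∀ b → (if b then α ℚ.* c zero ℚ.+ β ℚ.* d zero else 0ℚᵘ) ℚ.≃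
                      α ℚ.* (if b then c zero else 0ℚᵘ) ℚ.+ β ℚ.* (if b then d zero else 0ℚᵘ)
  distributes true  = ℚ.≃-refl
  distributes false = solve 2 (λ α β → con 0ℚᵘ := α :* con 0ℚᵘ :+ β :* con 0ℚᵘ) ℚ.≃-refl α β

-- The two-term rearrangement inequality: the difference of the sides is `(b - a) * (x - y)`, a
-- product of nonnegative factors.
swap-≤ : ∀ {a b x y} → a ℚ.≤ b → y ℚ.≤ x → a ℚ.* x ℚ.+ b ℚ.* y ℚ.≤ b ℚ.* x ℚ.+ a ℚ.* y
swap-≤ {a} {b} {x} {y} a≤b y≤x = ℚ.0≤q-p⇒p≤q (ℚ.≤-respʳ-≃
  (solve 4 (λ a b x y → (b :- a) :* (x :- y) := (b :* x :+ a :* y) :- (a :* x :+ b :* y)) ℚ.≃-refl a b x y)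
  (*-nonneg (ℚ.p≤q⇒0≤q-p a≤b) (ℚ.p≤q⇒0≤q-p y≤x)))
  where open +-*-Solver

permutation-2 : (σ : Permutation′ 2) → (σ ⟨$⟩ʳ zero ≡ zero × σ ⟨$⟩ʳ suc zero ≡ suc zero) ⊎
                                       (σ ⟨$⟩ʳ zero ≡ suc zero × σ ⟨$⟩ʳ suc zero ≡ zero)
permutation-2 σ with σ ⟨$⟩ʳ zero in eq₀ | σ ⟨$⟩ʳ suc zero in eq₁
... | zero     | suc zero = inj₁ (refl , refl)
... | suc zero | zero     = inj₂ (refl , refl)
... | zero     | zero     = contradiction (Injection.injective (↔⇒↣ σ) (trans eq₀ (sym eq₁))) λ ()
... | suc zero | suc zero = contradiction (Injection.injective (↔⇒↣ σ) (trans eq₀ (sym eq₁))) λ ()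

module _ (w : WeightVector 2) (w₀≤w₁ : weight w zero ℚ.≤ weight w (suc zero)) (v : Vector ℚᵘ 2) where

  private
    a = weight w zero
    b = weight w (suc zero)
    x = v zero
    y = v (suc zero)

  -- The two inequalities together with attainment say that OWA is the minimum of the two weighted
  -- sums.
  owa-minimum : (owa w v ℚ.≤ a ℚ.* x ℚ.+ b ℚ.* y) × (owa w v ℚ.≤ b ℚ.* x ℚ.+ a ℚ.* y) ×
                (owa w v ℚ.≃ a ℚ.* x ℚ.+ b ℚ.* y ⊎ owa w v ℚ.≃ b ℚ.* x ℚ.+ a ℚ.* y)
  owa-minimum = minimum (proj₁ (sorting v)) (proj₂ (sorting v))
    where
    -- An arbitrary sorting permutation is allowed, so its values can be rewritten without unfolding
    -- `sorting`.
    minimum : (σ : Permutation′ 2) → Nonincreasing (v ∘ (σ ⟨$⟩ʳ_)) →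
              let o = Σℚ (λ j → weight w j ℚ.* v (σ ⟨$⟩ʳ j)) in
              (o ℚ.≤ a ℚ.* x ℚ.+ b ℚ.* y) × (o ℚ.≤ b ℚ.* x ℚ.+ a ℚ.* y) ×
              (o ℚ.≃ a ℚ.* x ℚ.+ b ℚ.* y ⊎ o ℚ.≃ b ℚ.* x ℚ.+ a ℚ.* y)
    minimum σ mono with mono {zero} {suc zero} z≤n | permutation-2 σ
    ... | v₁≤v₀ | inj₁ (σ₀ , σ₁) rewrite σ₀ | σ₁ =
      ℚ.≤-reflexive o≃ , ℚ.≤-trans (ℚ.≤-reflexive o≃) (swap-≤ w₀≤w₁ v₁≤v₀) , inj₁ o≃
      where o≃ = ℚ.+-congʳ (a ℚ.* x) (ℚ.+-identityʳ (b ℚ.* y))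
    -- The indices in `v₁≤v₀` are sorted positions: here it states `x ≤ y`, so `swap-≤` is used with
    -- `x` and `y` exchanged.
    ... | v₁≤v₀ | inj₂ (σ₀ , σ₁) rewrite σ₀ | σ₁ =
      ℚ.≤-trans (ℚ.≤-reflexive o≃) (ℚ.≤-trans (ℚ.≤-reflexive (ℚ.+-comm (b ℚ.* x) (a ℚ.* y)))
        (ℚ.≤-trans (swap-≤ w₀≤w₁ v₁≤v₀) (ℚ.≤-reflexive (ℚ.+-comm (b ℚ.* y) (a ℚ.* x))))) ,
      ℚ.≤-reflexive o≃ , inj₂ o≃
      where
      o≃ = ℚ.≃-trans (ℚ.+-congʳ (a ℚ.* y) (ℚ.+-identityʳ (b ℚ.* x))) (ℚ.+-comm (a ℚ.* y) (b ℚ.* x))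

-- The algorithm and its correctness

solvable-by : (Q : MinProblem) → let open MinProblem Q in
              (answer : (I : Instance) → Maybe (Subset (ground I))) →
              PolyTime encode (encodeAnswer ∘ answer) → (∀ I → Correct I (answer I)) →
              PolynomiallySolvable Q
solvable-by Q answer L correct = program , factor , degree , λ I →
  let t , r , t≤ = run I in answer I , t , r , t≤ , correct I
  where open PolyTime L

module _ (P : CombinatorialProblem) where

  open CombinatorialProblem P
  open MinProblem (deterministic P) using () renaming (Instance to Instance₁; encode to encode₁; Correct to Correct₁)

  Instance₂ : Set
  Instance₂ = Σ Structure λ S → ScenarioSet 2 (elements S)

  encode₂ : Instance₂ → Val
  encode₂ (S , Γ , _) = pair (encode S) (list (encodeCosts ∘ Γ))

  -- Instantiated twice below, with the two weights in either order, to give the costs `a` and `b`.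
  module Scalarization (solvable : PolynomiallySolvable (deterministic P))
                       (α β : ℚᵘ) (0≤α : 0ℚᵘ ℚ.≤ α) (0≤β : 0ℚᵘ ℚ.≤ β) where

    scalarize : Instance₂ → Instance₁
    scalarize (S , Γ , _) = S , combine α β 0≤α 0≤β (Γ zero) (Γ (suc zero))

    weighted : Val → Val
    weighted z = encodeℚ α *ᵥ eval left z +ᵥ encodeℚ β *ᵥ eval right z

    -- The weights are parameters of the problem rather than input, so they enter the program as
    -- constants.
    weightedₗ : LinTime id weighted
    weightedₗ = sums (products (constantℚ α) (lefts here)) (products (constantℚ β) (rights here))

    weighted-costs : ∀ {n} (c d : CostVector n) →
      encodeList (map weighted (zipPad (tabulate (encodeℚ ∘ proj₁ c)) (tabulate (encodeℚ ∘ proj₁ d)))) ≡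
      encodeCosts (combine α β 0≤α 0≤β c d)
    weighted-costs (c , c≥0) (d , d≥0) = trans
      (map-zipPad weighted (encodeℚ ∘ c) (encodeℚ ∘ d))
      (list-cong λ i → sym (trans
        (encodeℚ-+ (*-nonneg 0≤α (c≥0 i)) (*-nonneg 0≤β (d≥0 i)))
        (cong₂ _+ᵥ_ (encodeℚ-* α (c i)) (encodeℚ-* β (d i)))))

    scalarizeₚ : PolyTime encode₂ (encode₁ ∘ scalarize)
    scalarizeₚ = pairingₚ (poly (lefts here))
      (afterₚ (poly (pairing (lefts (rights here)) (lefts (rights (rights here)))))
        (castₚ (λ (_ , Γ , _) → cong₂ pair (sym (tabulate-list (encodeℚ ∘ proj₁ (Γ zero))))
                                           (sym (tabulate-list (encodeℚ ∘ proj₁ (Γ (suc zero))))))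
               (λ (_ , Γ , _) → weighted-costs (Γ zero) (Γ (suc zero)))
          (restrictₚ (afterₚ reverse-zipₚ (restrictₚ (reverse-mapₚ weightedₗ) (λ (u , v) → zipPad u v)))
            (λ (_ , Γ , _) → tabulate (encodeℚ ∘ proj₁ (Γ zero)) , tabulate (encodeℚ ∘ proj₁ (Γ (suc zero)))))))

    answer : (I : Instance₂) → Maybe (Subset (elements (proj₁ I)))
    answer I = let _ , _ , _ , solve = solvable in proj₁ (solve (scalarize I))

    answer-correct : ∀ I → Correct₁ (scalarize I) (answer I)
    answer-correct I = let _ , _ , _ , solve = solvable ; _ , _ , _ , _ , correct = solve (scalarize I) in correct

    answerₚ : PolyTime encode₂ (encodeAnswer ∘ answer)
    answerₚ = let p , a , d , solve = solvable in
      afterₚ scalarizeₚ (record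
        { program = p
        ; factor  = a
        ; degree  = d
        ; run     = λ I → let _ , t , r , t≤ , _ = solve (scalarize I) in t , r , t≤
        })

    bits : ∀ {n} → Maybe (Subset n) → List Val
    bits nothing  = []
    bits (just X) = tabulate (bit ∘ lookup X)

    bits-answer : ∀ {n} (X : Maybe (Subset n)) → eval right (encodeAnswer X) ≡ encodeList (bits X)
    bits-answer nothing  = refl
    bits-answer (just X) = tabulate-list (bit ∘ lookup X)

    costs : (I : Instance₂) → Vector ℚᵘ (elements (proj₁ I))
    costs I = proj₁ (proj₂ (scalarize I))

    -- For `nothing` the padding makes this a sum of zeros, so a fraction is available for
    -- comparison in every case.
    value : (I : Instance₂) → Maybe (Subset (elements (proj₁ I))) → Val
    value I X = total (zipPad (tabulate (encodeℚ ∘ costs I)) (bits X))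

    valueₚ : PolyTime encode₂ (λ I → value I (answer I))
    valueₚ = afterₚ (pairingₚ (afterₚ scalarizeₚ (poly (rights here))) (afterₚ answerₚ (poly (rights here))))
      (castₚ (λ I → cong₂ pair (sym (tabulate-list (encodeℚ ∘ costs I))) (sym (bits-answer (answer I)))) (λ _ → refl)
        (restrictₚ (afterₚ reverse-zipₚ (restrictₚ reverse-totalₚ (λ (u , v) → zipPad u v)))
          (λ I → tabulate (encodeℚ ∘ costs I) , bits (answer I))))

  module _ (w : WeightVector 2) (w₀≤w₁ : weight w zero ℚ.≤ weight w (suc zero))
           (solvable : PolynomiallySolvable (deterministic P)) where

    open MinProblem (Min-Owa P w) using (Correct; objective)

    module A = Scalarization solvable (weight w zero) (weight w (suc zero)) (weight≥0 w zero) (weight≥0 w (suc zero))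
    module B = Scalarization solvable (weight w (suc zero)) (weight w zero) (weight≥0 w (suc zero)) (weight≥0 w zero)

    better : Val → Val → Bool
    better u v = numerator u * denominator v ≤ᵇ numerator v * denominator u

    pick : (I : Instance₂) (X Y : Maybe (Subset (elements (proj₁ I)))) → Maybe (Subset (elements (proj₁ I)))
    pick I X Y = if better (A.value I X) (B.value I Y) then X else Y

    best : (I : Instance₂) → Maybe (Subset (elements (proj₁ I)))
    best I = pick I (A.answer I) (B.answer I)

    choose-bit : ∀ b {n} (X Y : Maybe (Subset n)) →
                 choose (bit b) (encodeAnswer X) (encodeAnswer Y) ≡ encodeAnswer (if b then X else Y)
    choose-bit true  X Y = refl
    choose-bit false X Y = refl

    bestₚ : PolyTime encode₂ (encodeAnswer ∘ best)
    bestₚ = castₚ (λ _ → refl) (λ I → choose-bit (better (A.value I (A.answer I)) (B.value I (B.answer I))) (A.answer I) (B.answer I))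
      -- Each answer is computed once for its value and once for the output, so the deterministic
      -- program runs four times.
      (afterₚ (pairingₚ (pairingₚ A.valueₚ B.valueₚ) (pairingₚ A.answerₚ B.answerₚ))
        (poly (conditional
          ((lefts (lefts (lefts here)) ⊗ rights (rights (lefts here))) ⊴
           (lefts (rights (lefts here)) ⊗ rights (lefts (lefts here))))
          (lefts (rights here))
          (rights (rights here)))))

    module _ (I : Instance₂) where

      private
        Γ = proj₁ (proj₂ I)

      module _ (X : Subset (elements (proj₁ I))) where

        private
          a = weight w zero
          b = weight w (suc zero)
          c = proj₁ (Γ zero)
          d = proj₁ (Γ (suc zero))
          minimum = owa-minimum w w₀≤w₁ (λ j → F X (proj₁ (Γ j)))

        objective≤A : objective I X ℚ.≤ F X (A.costs I)
        objective≤A = ℚ.≤-respʳ-≃ (ℚ.≃-sym (F-linear a b X c d)) (proj₁ minimum)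

        objective≤B : objective I X ℚ.≤ F X (B.costs I)
        objective≤B = ℚ.≤-respʳ-≃ (ℚ.≃-sym (F-linear b a X c d)) (proj₁ (proj₂ minimum))

        -- OWA equals one of the two scalarized values, so a lower bound of both bounds it.
        ≤objective : ∀ {q} → q ℚ.≤ F X (A.costs I) → q ℚ.≤ F X (B.costs I) → q ℚ.≤ objective I X
        ≤objective {q} q≤A q≤B = bound (proj₂ (proj₂ minimum))
          where
          bound : ∀ {o} → o ℚ.≃ a ℚ.* F X c ℚ.+ b ℚ.* F X d ⊎ o ℚ.≃ b ℚ.* F X c ℚ.+ a ℚ.* F X d → q ℚ.≤ o
          bound (inj₁ o≃) = ℚ.≤-respʳ-≃ (ℚ.≃-trans (F-linear a b X c d) (ℚ.≃-sym o≃)) q≤A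
          bound (inj₂ o≃) = ℚ.≤-respʳ-≃ (ℚ.≃-trans (F-linear b a X c d) (ℚ.≃-sym o≃)) q≤B

      -- The chosen set has OWA at most its own scalarized value, which is at most both optimal
      -- values. These bound both scalarized values of any feasible `Z` from below, hence its OWA.
      if-correct : ∀ t X Y → Correct₁ (A.scalarize I) (just X) → Correct₁ (B.scalarize I) (just Y) →
                   (T t → F X (A.costs I) ℚ.≤ F Y (B.costs I)) → (¬ T t → F Y (B.costs I) ℚ.≤ F X (A.costs I)) →
                   Correct I (if t then just X else just Y)
      if-correct true  X Y (X∈Φ , X-minimal) (_ , Y-minimal) A≤B _ = X∈Φ , λ Z Z∈Φ →
        ≤objective Z (ℚ.≤-trans (objective≤A X) (X-minimal Z Z∈Φ))
                     (ℚ.≤-trans (objective≤A X) (ℚ.≤-trans (A≤B _) (Y-minimal Z Z∈Φ)))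
      if-correct false X Y (_ , X-minimal) (Y∈Φ , Y-minimal) _ B≤A = Y∈Φ , λ Z Z∈Φ →
        ≤objective Z (ℚ.≤-trans (objective≤B Y) (ℚ.≤-trans (B≤A λ ()) (X-minimal Z Z∈Φ)))
                     (ℚ.≤-trans (objective≤B Y) (Y-minimal Z Z∈Φ))

      -- Both scalarized instances have the feasible sets of the original one, so the answers are
      -- `nothing` together or not at all.
      pick-correct : ∀ X Y → Correct₁ (A.scalarize I) X → Correct₁ (B.scalarize I) Y → Correct I (pick I X Y)
      pick-correct nothing  nothing  infeasible _ = if-idem (better (A.value I nothing) (B.value I nothing))
        where
        if-idem : ∀ t → Correct I (if t then nothing else nothing)
        if-idem true  = infeasible
        if-idem false = infeasible
      pick-correct nothing  (just Y) infeasible (Y∈Φ , _) = contradiction Y∈Φ (infeasible Y)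
      pick-correct (just X) nothing  (X∈Φ , _) infeasible = contradiction X∈Φ (infeasible X)
      pick-correct (just X) (just Y) X-optimal Y-optimal =
        -- By `total-F` the computed values are the encoded objective values, so `better` is their
        -- comparison by cross multiplication.
        subst₂ (λ u v → Correct I (if better u v then just X else just Y))
          (sym (total-F X (proj₂ (A.scalarize I)))) (sym (total-F Y (proj₂ (B.scalarize I))))
          (if-correct _ X Y X-optimal Y-optimal
            (λ t → cross-≤ FX≥0 FY≥0 (≤ᵇ⇒≤ _ _ t))
            (λ ¬t → cross-≤ FY≥0 FX≥0 (<⇒≤ (≰⇒> (¬t ∘ ≤⇒≤ᵇ)))))
        where
        FX≥0 = F-nonneg X (proj₂ (A.scalarize I))
        FY≥0 = F-nonneg Y (proj₂ (B.scalarize I))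

    Min-Owa-solvable : PolynomiallySolvable (Min-Owa P w)
    Min-Owa-solvable = solvable-by (Min-Owa P w) best bestₚ
      (λ I → pick-correct I _ _ (A.answer-correct I) (B.answer-correct I))

-- The chain runs through `½`, which equals `1 - ½`.
α≤1-α : ∀ {α} → α ℚ.≤ ½ → α ℚ.≤ 1ℚᵘ ℚ.- α
α≤1-α α≤½ = ℚ.≤-trans α≤½ (ℚ.≤-trans (ℚ.≤-reflexive (ℚ.*≡* refl)) (ℚ.+-monoʳ-≤ 1ℚᵘ (ℚ.neg-mono-≤ α≤½)))

theorem2 : (P : CombinatorialProblem) (α : ℚᵘ) (0≤α : 0ℚᵘ ℚ.≤ α) (α≤½ : α ℚ.≤ ½) →
    PolynomiallySolvable (deterministic P) →
    PolynomiallySolvable (Min-Owa P (two-weights α 0≤α α≤½))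
theorem2 P α 0≤α α≤½ = Min-Owa-solvable P (two-weights α 0≤α α≤½) (α≤1-α α≤½)
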